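{- Let $b\ge 2$ be even and $n\ge 1$. Then $\{b^{n+i}+1 : i\in\{0,1,\dots,n\}\}$ is the minimal system of generators of $SC^{+}(b,n)$; in particular $e(SC^{+}(b,n))=n+1$.
   Context: For an even integer $b\ge2$ and $n\ge0$, $SC^{+}(b,n)=\langle\{b^{n+i}+1: i\in\mathbb{N}\}\rangle$, the submonoid of $(\mathbb{N},+)$ generated by these numbers (a numerical semigroup). The minimal system of generators of a numerical semigroup $S$ is the unique generating set no proper subset of which generates $S$; $e(S)$ is its cardinality. -}

module Defs where

open import Data.Fin.Base using (Fin)
open import Data.Nat.Base using (ℕ; _+_; _^_)
open import Data.Product.Base using (Σ; ∃; ∃-syntax; _×_; proj₁)
open import Function.Bundles using (Bijection)
open import Level using (0ℓ)
import Relation.Binary.Construct.On as On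
open import Relation.Binary.PropositionalEquality using (_≡_; setoid)
open import Relation.Nullary.Negation.Core using (¬_)
open import Relation.Unary using (Pred; _≐_; _⊂_)

data ⟨_⟩ (A : Pred ℕ 0ℓ) : Pred ℕ 0ℓ where
  gen  : ∀ {x} → A x → ⟨ A ⟩ x
  zero : ⟨ A ⟩ 0
  add  : ∀ {x y} → ⟨ A ⟩ x → ⟨ A ⟩ y → ⟨ A ⟩ (x + y)

SC⁺ : ℕ → ℕ → Pred ℕ 0ℓ
SC⁺ b n = ⟨ (λ x → ∃[ i ] x ≡ b ^ (n + i) + 1) ⟩

_Generates_ : Pred ℕ 0ℓ → Pred ℕ 0ℓ → Set
A Generates S = ⟨ A ⟩ ≐ S

record IsIrredundantGeneratingSet (S A : Pred ℕ 0ℓ) : Set₁ where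
  field
    generates   : A Generates S
    irredundant : ∀ (B : Pred ℕ 0ℓ) → B ⊂ A → ¬ (B Generates S)

-- Uniqueness is part of the notion: "the" minimal system of generators is
-- the unique irredundant generating set.
record IsMinimalSystemOfGenerators (S A : Pred ℕ 0ℓ) : Set₁ where
  field
    isIrredundant : IsIrredundantGeneratingSet S A
    unique : ∀ (B : Pred ℕ 0ℓ) → IsIrredundantGeneratingSet S B → B ≐ A

-- Elements of the subset A are compared as natural numbers, ignoring their
-- membership proofs, so that each element is counted once.
HasCardinality : Pred ℕ 0ℓ → ℕ → Set
HasCardinality A k =
  Bijection (setoid (Fin k)) (On.setoid {B = ∃ A} (setoid ℕ) proj₁)

-- HasEmbeddingDimension S k expresses e(S) = k.
HasEmbeddingDimension : Pred ℕ 0ℓ → ℕ → Set₁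
HasEmbeddingDimension S k =
  Σ (Pred ℕ 0ℓ) λ A → IsMinimalSystemOfGenerators S A × HasCardinality A k

{-# OPTIONS --safe #-}

-- Write p = b ^ n.  A sum of s generators has the form p * q + s with s ≤ q.
-- If it equals p * b ^ i + 1 with s ≥ 2, then s ≡ 1 (mod p) forces s > p, hence
-- q > p ≥ b ^ i for i ≤ n, which is too big.  So the first n + 1 generators are
-- indecomposable, hence lie in every generating set.  The later generators are
-- redundant because p ^ 2 ≡ 1 (mod p + 1): for 0 ≤ r ≤ n,
--   b ^ (2n + r) + 1 = b ^ r (b ^ (2n - r) + 1) + (b ^ r - 1) (p - 1) (p + 1),
-- and for all j,
--   b ^ (3n + j) + 1 = (b ^ (n + j) + 1) + b ^ (n + j) (p - 1) (p + 1).

module Submission where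

open import Data.Fin.Base using (Fin; toℕ; fromℕ<)
open import Data.Fin.Properties using (toℕ<n; toℕ-fromℕ<; toℕ-injective)
open import Data.Nat using (ℕ; zero; suc; pred; _+_; _*_; _∸_; _^_; _≤_; _<_; z≤n; s≤s; z<s; NonZero; >-nonZero)
open import Data.Nat.Divisibility using (_∣_)
open import Data.Nat.Induction using (<-rec)
open import Data.Nat.Properties
open import Data.Nat.Tactic.RingSolver using (solve-∀)
open import Data.Product using (∃-syntax; _×_; _,_; proj₁)
open import Data.Sum using (inj₁; inj₂)
open import Level using (0ℓ)
open import Relation.Binary using (tri<; tri≈; tri>)
open import Relation.Binary.PropositionalEquality using (_≡_; _≢_; refl; sym; trans; cong; cong₂; subst; module ≡-Reasoning)
open import Relation.Nullary using (yes; no; contradiction)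
open import Relation.Nullary.Decidable using (map′)
open import Relation.Unary using (Pred; Decidable; _⊆_)
open import Defs

-- Submonoids of ℕ and indecomposable elements

⟨⟩-least : ∀ {A B : Pred ℕ 0ℓ} → A ⊆ ⟨ B ⟩ → ⟨ A ⟩ ⊆ ⟨ B ⟩
⟨⟩-least A⊆⟨B⟩ (gen x∈A) = A⊆⟨B⟩ x∈A
⟨⟩-least A⊆⟨B⟩ zero      = zero
⟨⟩-least A⊆⟨B⟩ (add p q) = add (⟨⟩-least A⊆⟨B⟩ p) (⟨⟩-least A⊆⟨B⟩ q)

⟨⟩-mult : ∀ {A : Pred ℕ 0ℓ} {x} k → ⟨ A ⟩ x → ⟨ A ⟩ (k * x)
⟨⟩-mult zero    p = zero
⟨⟩-mult (suc k) p = add p (⟨⟩-mult k p)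

record Indecomposable (S : Pred ℕ 0ℓ) (a : ℕ) : Set where
  field
    nonzero : a ≢ 0
    noSplit : ∀ {x y} → S x → S y → x ≢ 0 → y ≢ 0 → a ≢ x + y

-- In a derivation of `a`, every `add` node must have a zero summand, so following the other summand
-- leads down to a generator equal to `a`.
indecomposable∈generators : ∀ {S B : Pred ℕ 0ℓ} {a} → Indecomposable S a →
                            ⟨ B ⟩ ⊆ S → ⟨ B ⟩ a → B a
indecomposable∈generators {S} {B} {a} ind ⟨B⟩⊆S = λ p → go p refl
  where
  open Indecomposable ind
  go : ∀ {x} → ⟨ B ⟩ x → x ≡ a → B a
  go (gen x∈B) refl = x∈B
  go zero      0≡a  = contradiction (sym 0≡a) nonzero
  go (add {x} {y} p q) x+y≡a with x ≟ 0 | y ≟ 0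
  ... | yes refl | _        = go q x+y≡a
  ... | no _     | yes refl = go p (trans (sym (+-identityʳ x)) x+y≡a)
  ... | no x≢0   | no y≢0   =
    contradiction (sym x+y≡a) (noSplit (⟨B⟩⊆S p) (⟨B⟩⊆S q) x≢0 y≢0)

-- Every generating set contains `A`, so no proper subset of `A` generates, and an irredundant `B`
-- cannot properly contain the generating set `A`.
indecomposables⇒minimal : ∀ {S A : Pred ℕ 0ℓ} → Decidable A → A Generates S →
                          A ⊆ Indecomposable S → IsMinimalSystemOfGenerators S A
indecomposables⇒minimal {S} {A} A? A-gen@(⟨A⟩⊆S , _) A-ind = record
  { isIrredundant = record
    { generates   = A-gen
    ; irredundant = λ { B (_ , A⊈B) B-gen → A⊈B (A⊆ B B-gen) }
    }
  ; unique = λ B B-irr → B⊆A B B-irr , A⊆ B (generates B-irr)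
  }
  where
  open IsIrredundantGeneratingSet
  A⊆ : ∀ B → B Generates S → A ⊆ B
  A⊆ B (⟨B⟩⊆S , S⊆⟨B⟩) x∈A =
    indecomposable∈generators (A-ind x∈A) ⟨B⟩⊆S (S⊆⟨B⟩ (⟨A⟩⊆S (gen x∈A)))
  B⊆A : ∀ B → IsIrredundantGeneratingSet S B → B ⊆ A
  B⊆A B B-irr {x} x∈B with A? x
  -- Irredundancy of `B` only refutes `x ∉ A`; deciding `A` turns that into membership.
  ... | yes x∈A = x∈A
  ... | no  x∉A = contradiction A-gen
    (irredundant B-irr A (A⊆ B (generates B-irr) , λ B⊆A → x∉A (B⊆A x∈B)))

-- The generators of SC⁺ b n

FirstGenerators : ℕ → ℕ → Pred ℕ 0ℓ
FirstGenerators b n x = ∃[ i ] (i ≤ n × x ≡ b ^ (n + i) + 1)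

firstGenerators? : ∀ b n → Decidable (FirstGenerators b n)
firstGenerators? b n x =
  map′ (λ { (i , s≤s i≤n , eq) → i , i≤n , eq })
       (λ { (i , i≤n , eq) → i , s≤s i≤n , eq })
       (anyUpTo? (λ i → x ≟ b ^ (n + i) + 1) (suc n))

-- Redundancy of the later generators

^-split₂ : ∀ b n r → b ^ (n + (n + r)) ≡ b ^ n * b ^ n * b ^ r
^-split₂ b n r = begin
  b ^ (n + (n + r))       ≡⟨ ^-distribˡ-+-* b n (n + r) ⟩
  b ^ n * b ^ (n + r)     ≡⟨ cong (b ^ n *_) (^-distribˡ-+-* b n r) ⟩
  b ^ n * (b ^ n * b ^ r) ≡⟨ *-assoc (b ^ n) (b ^ n) (b ^ r) ⟨
  b ^ n * b ^ n * b ^ r   ∎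
  where open ≡-Reasoning

-- Since `c * m` is the square of `p`, the difference of the right side and `c * (m + 1)` factors as
-- (c - 1)(p² - 1). Used with `c = b ^ r` and `m = b ^ (n + (n ∸ r))`.
reduction-small : ∀ p c m .{{_ : NonZero p}} .{{_ : NonZero c}} → c * m ≡ p * p →
                  c * (m + 1) + pred c * pred p * (p + 1) ≡ p * p * c + 1
reduction-small p@(suc d) c@(suc e) m cm≡pp = begin
  c * (m + 1) + e * d * (p + 1)   ≡⟨ cong (_+ e * d * (p + 1)) (*-distribˡ-+ c m 1) ⟩
  c * m + c * 1 + e * d * (p + 1) ≡⟨ cong (λ z → z + c * 1 + e * d * (p + 1)) cm≡pp ⟩
  p * p + c * 1 + e * d * (p + 1) ≡⟨ identity d e ⟩
  p * p * c + 1                   ∎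
  where
  open ≡-Reasoning
  identity : ∀ d e → suc d * suc d + suc e * 1 + e * d * (suc d + 1) ≡
                     suc d * suc d * suc e + 1
  identity = solve-∀

reduction-large : ∀ p c .{{_ : NonZero p}} →
                  (c + 1) + c * pred p * (p + 1) ≡ p * p * c + 1
reduction-large (suc d) c = identity d c
  where
  identity : ∀ d c → (c + 1) + c * d * (suc d + 1) ≡ suc d * suc d * c + 1
  identity = solve-∀

module _ (b n : ℕ) .{{_ : NonZero b}} where

  firstGenerator : ∀ {i} → i ≤ n → ⟨ FirstGenerators b n ⟩ (b ^ (n + i) + 1)
  firstGenerator i≤n = gen (_ , i≤n , refl)

  p+1∈ : ⟨ FirstGenerators b n ⟩ (b ^ n + 1)
  p+1∈ = subst (λ k → ⟨ FirstGenerators b n ⟩ (b ^ k + 1)) (+-identityʳ n) (firstGenerator z≤n)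

  -- Indices from `n` to `2 * n` are reflected by `small`: `n + r` reduces to `n ∸ r`, already a
  -- first generator. Only indices from `2 * n` on recurse, dropping by `2 * n`.
  generator∈ : 1 ≤ n → ∀ i → ⟨ FirstGenerators b n ⟩ (b ^ (n + i) + 1)
  generator∈ 1≤n = <-rec _ step
    where
    p = b ^ n
    G = ⟨ FirstGenerators b n ⟩

    small : ∀ {r} → r ≤ n → G (b ^ (n + (n + r)) + 1)
    small {r} r≤n = subst G eq
      (add (⟨⟩-mult (b ^ r) (firstGenerator (m∸n≤m n r)))
           (⟨⟩-mult (pred (b ^ r) * pred p) p+1∈))
      where
      open ≡-Reasoning
      exponents : r + (n + (n ∸ r)) ≡ n + n
      exponents = begin
        r + (n + (n ∸ r)) ≡⟨ +-comm r _ ⟩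
        n + (n ∸ r) + r   ≡⟨ +-assoc n _ r ⟩
        n + (n ∸ r + r)   ≡⟨ cong (n +_) (m∸n+n≡m r≤n) ⟩
        n + n             ∎
      powers : b ^ r * b ^ (n + (n ∸ r)) ≡ p * p
      powers = begin
        b ^ r * b ^ (n + (n ∸ r)) ≡⟨ ^-distribˡ-+-* b r _ ⟨
        b ^ (r + (n + (n ∸ r)))   ≡⟨ cong (b ^_) exponents ⟩
        b ^ (n + n)               ≡⟨ ^-distribˡ-+-* b n n ⟩
        p * p                     ∎
      eq = trans (reduction-small p (b ^ r) _ {{m^n≢0 b n}} {{m^n≢0 b r}} powers)
                 (cong (_+ 1) (sym (^-split₂ b n r)))

    large : ∀ {j} → G (b ^ (n + j) + 1) → G (b ^ (n + (n + (n + j))) + 1)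
    large {j} g = subst G
      (trans (reduction-large p (b ^ (n + j)) {{m^n≢0 b n}}) (cong (_+ 1) (sym (^-split₂ b n (n + j)))))
      (add g (⟨⟩-mult (b ^ (n + j) * pred p) p+1∈))

    step : ∀ i → (∀ {j} → j < i → G (b ^ (n + j) + 1)) → G (b ^ (n + i) + 1)
    step i rec with ≤-total i n
    ... | inj₁ i≤n = firstGenerator i≤n
    ... | inj₂ n≤i with m≤n⇒∃[o]m+o≡n n≤i
    ...   | r , refl with ≤-total r n
    ...     | inj₁ r≤n = small r≤n
    ...     | inj₂ n≤r with m≤n⇒∃[o]m+o≡n n≤r
    -- Here `i` is `n + (n + j)`, and `1 ≤ n` makes `j` strictly smaller.
    ...       | j , refl = large (rec (+-mono-≤ 1≤n (m≤n+m j n)))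

  firstGenerators-generate : 1 ≤ n → FirstGenerators b n Generates SC⁺ b n
  firstGenerators-generate 1≤n =
      ⟨⟩-least (λ { (i , _ , eq) → gen (i , eq) })
    , ⟨⟩-least (λ { (i , refl) → generator∈ 1≤n i })

  -- Indecomposability of the first generators

  -- s is the number of generators, with multiplicity, in a sum equal to x.
  summandCount : ∀ {x} → SC⁺ b n x →
                 ∃[ q ] ∃[ s ] (x ≡ b ^ n * q + s × s ≤ q × (s ≡ 0 → x ≡ 0))
  summandCount (gen (i , refl)) =
    b ^ i , 1 , cong (_+ 1) (^-distribˡ-+-* b n i) , m^n>0 b i , λ ()
  summandCount zero = 0 , 0 , sym (trans (+-identityʳ _) (*-zeroʳ (b ^ n))) , z≤n , λ _ → refl
  summandCount (add {x} {y} x∈S y∈S) with summandCount x∈S | summandCount y∈S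
  ... | q , s , x≡ , s≤q , x-zero | r , t , y≡ , t≤r , y-zero =
      q + r , s + t
    , trans (cong₂ _+_ x≡ y≡) (identity (b ^ n) q s r t)
    , +-mono-≤ s≤q t≤r
    , λ s+t≡0 → cong₂ _+_ (x-zero (m+n≡0⇒m≡0 s s+t≡0)) (y-zero (m+n≡0⇒n≡0 s s+t≡0))
    where
    identity : ∀ p q s r t → (p * q + s) + (p * r + t) ≡ p * (q + r) + (s + t)
    identity = solve-∀

  firstGenerators-indecomposable : FirstGenerators b n ⊆ Indecomposable (SC⁺ b n)
  firstGenerators-indecomposable (i , i≤n , refl) = record
    { nonzero = λ eq → 1+n≢0 (trans (+-comm 1 _) eq)
    ; noSplit = noSplit
    }
    where
    noSplit : ∀ {x y} → SC⁺ b n x → SC⁺ b n y → x ≢ 0 → y ≢ 0 → b ^ (n + i) + 1 ≢ x + y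
    noSplit x∈S y∈S x≢0 y≢0 eq with summandCount x∈S | summandCount y∈S
    -- A nonzero summand uses at least one generator, so both counts are successors.
    ... | q , zero  , _  , _   , x-zero | _ = x≢0 (x-zero refl)
    ... | q , suc s , _  , _   , _      | r , zero  , _  , _   , y-zero = y≢0 (y-zero refl)
    ... | q , suc s , x≡ , s<q , _      | r , suc t , y≡ , t<r , _      =
      <-irrefl refl (begin-strict
        b ^ n         ≤⟨ p≤1+s+t ⟩
        suc s + t     <⟨ +-mono-≤-< s<q t<r ⟩
        q + r         <⟨ q+r<b^i ⟩
        b ^ i         ≤⟨ ^-monoʳ-≤ b i≤n ⟩
        b ^ n         ∎)
      where
      open ≤-Reasoning
      p = b ^ n

      identity : ∀ p q s r t → (p * q + suc s) + (p * r + suc t) ≡ suc (p * (q + r) + (suc s + t))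
      identity = solve-∀

      -- Cancelling the 1 of the generator leaves `suc s + t`, one less than the total count and
      -- still positive.
      p*b^i≡ : p * b ^ i ≡ p * (q + r) + (suc s + t)
      p*b^i≡ = suc-injective (begin-equality
        suc (p * b ^ i)                   ≡⟨ +-comm 1 _ ⟩
        p * b ^ i + 1                     ≡⟨ cong (_+ 1) (^-distribˡ-+-* b n i) ⟨
        b ^ (n + i) + 1                   ≡⟨ eq ⟩
        _                                 ≡⟨ cong₂ _+_ x≡ y≡ ⟩
        (p * q + suc s) + (p * r + suc t) ≡⟨ identity p q s r t ⟩
        suc (p * (q + r) + (suc s + t))   ∎)

      q+r<b^i : q + r < b ^ i
      q+r<b^i = *-cancelˡ-< p (q + r) (b ^ i) (begin-strict
        p * (q + r)               <⟨ m<m+n _ z<s ⟩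
        p * (q + r) + (suc s + t) ≡⟨ p*b^i≡ ⟨
        p * b ^ i                 ∎)

      p≤1+s+t : p ≤ suc s + t
      p≤1+s+t = +-cancelˡ-≤ (p * (q + r)) _ _ (begin
        p * (q + r) + p           ≡⟨ +-comm _ p ⟩
        p + p * (q + r)           ≡⟨ *-suc p (q + r) ⟨
        p * suc (q + r)           ≤⟨ *-monoʳ-≤ p q+r<b^i ⟩
        p * b ^ i                 ≡⟨ p*b^i≡ ⟩
        p * (q + r) + (suc s + t) ∎)

-- Counting the first generators

^-injectiveʳ : ∀ {b} → 1 < b → ∀ {i j} → b ^ i ≡ b ^ j → i ≡ j
^-injectiveʳ {b} 1<b {i} {j} eq with <-cmp i j
... | tri< i<j _ _ = contradiction eq (<⇒≢ (^-monoʳ-< b 1<b i<j))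
... | tri≈ _ i≡j _ = i≡j
... | tri> _ _ j<i = contradiction (sym eq) (<⇒≢ (^-monoʳ-< b 1<b j<i))

firstGenerators-cardinality : ∀ b n → 2 ≤ b → HasCardinality (FirstGenerators b n) (n + 1)
firstGenerators-cardinality b n 2≤b = record
  { to        = to
  ; cong      = λ { refl → refl }
  ; bijective = injective , surjective
  }
  where
  to : Fin (n + 1) → ∃[ x ] FirstGenerators b n x
  to k = _ , toℕ k , m<1+n⇒m≤n (subst (toℕ k <_) (+-comm n 1) (toℕ<n k)) , refl

  injective : ∀ {k l} → proj₁ (to k) ≡ proj₁ (to l) → k ≡ l
  injective eq = toℕ-injective (+-cancelˡ-≡ n _ _ (^-injectiveʳ 2≤b (+-cancelʳ-≡ 1 _ _ eq)))

  surjective : ∀ y → ∃[ k ] (∀ {l} → l ≡ k → proj₁ (to l) ≡ proj₁ y)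
  surjective (_ , i , i≤n , refl) =
    fromℕ< i<n+1 , λ { refl → cong (λ j → b ^ (n + j) + 1) (toℕ-fromℕ< i<n+1) }
    where
    i<n+1 : i < n + 1
    i<n+1 = subst (i <_) (+-comm 1 n) (s≤s i≤n)

mainTheorem15 : ∀ (b n : ℕ) → 2 ≤ b → 2 ∣ b → 1 ≤ n →
    IsMinimalSystemOfGenerators (SC⁺ b n) (λ x → ∃[ i ] (i ≤ n × x ≡ b ^ (n + i) + 1))
    × HasEmbeddingDimension (SC⁺ b n) (n + 1)
mainTheorem15 b n 2≤b _ 1≤n =
  minimal , FirstGenerators b n , minimal , firstGenerators-cardinality b n 2≤b
  where
  instance
    b≢0 : NonZero b
    b≢0 = >-nonZero (<⇒≤ 2≤b)

  minimal : IsMinimalSystemOfGenerators (SC⁺ b n) (FirstGenerators b n)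
  minimal = indecomposables⇒minimal (firstGenerators? b n)
    (firstGenerators-generate b n 1≤n) (firstGenerators-indecomposable b n)
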